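{- The class of $^\star$-involutive idempotent residuated chains has the strong amalgamation property.
   Context: A residuated lattice is an algebra $(A,\wedge,\vee,\cdot,\backslash,/,1)$ such that $(A,\wedge,\vee)$ is a lattice, $(A,\cdot,1)$ is a monoid, and $y\le x\backslash z \iff x\cdot y\le z\iff x\le z/y$ for all $x,y,z$. An idempotent residuated chain is a residuated lattice whose lattice order is total and which satisfies $x\cdot x=x$. Define $x^r:=x\backslash 1$, $x^\ell:=1/x$, $x^\star:=x^\ell\wedge x^r$. An idempotent residuated chain is $^\star$-involutive if it satisfies $x^{\star\star}=x$. A class $\mathcal K$ of similar algebras has the strong amalgamation property if for all $\mathbf A,\mathbf B,\mathbf C\in\mathcal K$ and embeddings $f_B\colon\mathbf A\to\mathbf B$, $f_C\colon\mathbf A\to\mathbf C$ there are $\mathbf D\in\mathcal K$ and embeddings $g_B\colon\mathbf B\to\mathbf D$, $g_C\colon\mathbf C\to\mathbf D$ with $g_B\circ f_B=g_C\circ f_C$ and $(g_B\circ f_B)[A]=g_B[B]\cap g_C[C]$. -}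

module Defs where

open import Level using (Level; suc; _⊔_)
open import Algebra.Core using (Op₁; Op₂)
open import Algebra.Structures using (IsMonoid)
open import Algebra.Bundles using (Monoid)
open import Algebra.Lattice.Structures using (IsLattice)
open import Algebra.Lattice.Bundles using (Lattice; RawLattice)
open import Algebra.Lattice.Morphism.Structures using (IsLatticeMonomorphism)
import Algebra.Definitions as AlgebraDefinitions
import Algebra.Morphism.Definitions as MorphismDefinitions
open import Data.Product using (Σ-syntax; ∃-syntax; _×_)
open import Function.Bundles using (_⇔_)
open import Relation.Binary.Core using (Rel)
open import Relation.Binary.Definitions using (Total)
import Relation.Binary.Construct.NaturalOrder.Left as NaturalOrder
open import Relation.Unary using (Pred; _≐_; _∩_)

-- The laws are stated up to the setoid equality _≈_, and the order is the
-- natural order of the lattice: x ≤ y means x ≈ x ∧ y.  Compatibility of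
-- _\\_ and _//_ with _≈_ is not a field because it follows from residuation.

record IsResiduatedLattice
  {c ℓ : Level} {A : Set c} (_≈_ : Rel A ℓ)
  (_∨_ _∧_ _∙_ _\\_ _//_ : Op₂ A) (ε : A) : Set (c ⊔ ℓ) where

  open AlgebraDefinitions _≈_
  open NaturalOrder _≈_ _∧_ public using (_≤_)

  field
    isLattice  : IsLattice _≈_ _∨_ _∧_
    ∙-cong     : Congruent₂ _∙_
    ∙-assoc    : Associative _∙_
    ∙-identity : Identity ε _∙_
    \\-residual : ∀ x y z → (y ≤ (x \\ z)) ⇔ ((x ∙ y) ≤ z)
    //-residual : ∀ x y z → ((x ∙ y) ≤ z) ⇔ (x ≤ (z // y))

  open IsLattice isLattice public

  isMonoid : IsMonoid _≈_ _∙_ ε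
  isMonoid = record
    { isSemigroup = record
      { isMagma = record { isEquivalence = isEquivalence ; ∙-cong = ∙-cong }
      ; assoc   = ∙-assoc
      }
    ; identity = ∙-identity
    }

record ResiduatedLattice (c ℓ : Level) : Set (suc (c ⊔ ℓ)) where
  infixl 8 _∙_
  infixl 8 _\\_
  infixl 8 _//_
  infixr 7 _∧_
  infixr 6 _∨_
  infix  4 _≈_
  infix  9 _ʳ _ˡ _⋆
  field
    Carrier : Set c
    _≈_     : Rel Carrier ℓ
    _∨_     : Op₂ Carrier
    _∧_     : Op₂ Carrier
    _∙_     : Op₂ Carrier
    _\\_    : Op₂ Carrier
    _//_    : Op₂ Carrier
    ε       : Carrier
    isResiduatedLattice : IsResiduatedLattice _≈_ _∨_ _∧_ _∙_ _\\_ _//_ ε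

  open IsResiduatedLattice isResiduatedLattice public

  lattice : Lattice c ℓ
  lattice = record { isLattice = isLattice }

  open Lattice lattice public using (rawLattice; setoid)

  monoid : Monoid c ℓ
  monoid = record { isMonoid = isMonoid }

  _ʳ : Op₁ Carrier
  x ʳ = x \\ ε

  _ˡ : Op₁ Carrier
  x ˡ = ε // x

  _⋆ : Op₁ Carrier
  x ⋆ = x ˡ ∧ x ʳ

record IsIdempotentResiduatedChain
  {c ℓ : Level} (A : ResiduatedLattice c ℓ) : Set (c ⊔ ℓ) where
  open ResiduatedLattice A
  open AlgebraDefinitions _≈_
  field
    ≤-total : Total _≤_
    ∙-idem  : Idempotent _∙_

record Is⋆InvolutiveIdempotentResiduatedChain
  {c ℓ : Level} (A : ResiduatedLattice c ℓ) : Set (c ⊔ ℓ) where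
  open ResiduatedLattice A
  open AlgebraDefinitions _≈_
  field
    isIdempotentResiduatedChain : IsIdempotentResiduatedChain A
    ⋆-involutive                : Involutive _⋆

  open IsIdempotentResiduatedChain isIdempotentResiduatedChain public

record IsEmbedding
  {c ℓ : Level} (A B : ResiduatedLattice c ℓ)
  (⟦_⟧ : ResiduatedLattice.Carrier A → ResiduatedLattice.Carrier B)
  : Set (c ⊔ ℓ) where
  private
    module A = ResiduatedLattice A
    module B = ResiduatedLattice B
  open MorphismDefinitions A.Carrier B.Carrier B._≈_
  field
    isLatticeMonomorphism : IsLatticeMonomorphism A.rawLattice B.rawLattice ⟦_⟧
    ∙-homo  : Homomorphic₂ ⟦_⟧ A._∙_ B._∙_
    \\-homo : Homomorphic₂ ⟦_⟧ A._\\_ B._\\_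
    //-homo : Homomorphic₂ ⟦_⟧ A._//_ B._//_
    ε-homo  : Homomorphic₀ ⟦_⟧ A.ε B.ε

  open IsLatticeMonomorphism isLatticeMonomorphism public

record Embedding {c ℓ : Level} (A B : ResiduatedLattice c ℓ) : Set (c ⊔ ℓ) where
  field
    ⟦_⟧         : ResiduatedLattice.Carrier A → ResiduatedLattice.Carrier B
    isEmbedding : IsEmbedding A B ⟦_⟧

  open IsEmbedding isEmbedding public

open Embedding using (⟦_⟧)

-- The set-theoretic image, closed under the equality of the codomain.

Image : {c ℓ : Level} {X : Set c} (B : ResiduatedLattice c ℓ) →
        (X → ResiduatedLattice.Carrier B) →
        Pred (ResiduatedLattice.Carrier B) (c ⊔ ℓ)
Image B f d = ∃[ x ] (f x ≈ d)
  where open ResiduatedLattice B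

record IsStrongAmalgam
  {c ℓ : Level} {A B C D : ResiduatedLattice c ℓ}
  (fB : Embedding A B) (fC : Embedding A C)
  (gB : Embedding B D) (gC : Embedding C D) : Set (c ⊔ ℓ) where
  open ResiduatedLattice D
  field
    commutes : ∀ a → ⟦ gB ⟧ (⟦ fB ⟧ a) ≈ ⟦ gC ⟧ (⟦ fC ⟧ a)
    strong   : Image D (λ a → ⟦ gB ⟧ (⟦ fB ⟧ a)) ≐
               (Image D ⟦ gB ⟧ ∩ Image D ⟦ gC ⟧)

-- A class of residuated lattices is a predicate on them; the amalgam is
-- required to live at the same universe levels as the given algebras.

StrongAmalgamationProperty :
  {c ℓ p : Level} → Pred (ResiduatedLattice c ℓ) p → Set (suc (c ⊔ ℓ) ⊔ p)
StrongAmalgamationProperty {c} {ℓ} K =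
  (A B C : ResiduatedLattice c ℓ) → K A → K B → K C →
  (fB : Embedding A B) (fC : Embedding A C) →
  ∃[ D ] K D × (Σ[ gB ∈ Embedding B D ] Σ[ gC ∈ Embedding C D ]
    IsStrongAmalgam fB fC gB gC)

-- An idempotent residuated chain is determined by its order, its unit and the maps
-- ʳ and ˡ: the product x ∙ y is x ∧ y if x ≤ y ˡ and x ∨ y otherwise.  Conversely a
-- Galois connection (ˡ, ʳ) on a chain gives such a product, and it is associative
-- as soon as each interval (y ˡ , y ʳ] has at most one element, and dually.
-- ⋆-involutivity forces an element of an extension of A to belong to A as soon as
-- one of its residuals does.  Hence B and C can be glued along A with ʳ and ˡ defined
-- componentwise, ordering elements b ∉ A and c ∉ A of the same cut of A as b < c
-- below ε and as c < b above ε: the two conventions are exchanged by ⋆.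

module Submission where

open import Defs
open import Level using (Level; _⊔_; suc; Lift; lift; lower)
open import Axiom.ExcludedMiddle using (ExcludedMiddle)
open import Algebra.Core using (Op₁; Op₂)
import Algebra.Construct.NaturalChoice.Max as NaturalMax
import Algebra.Construct.NaturalChoice.Min as NaturalMin
import Algebra.Definitions as AlgebraDefinitions
import Algebra.Lattice.Construct.NaturalChoice.MinMaxOp as MinMaxLattice
import Algebra.Lattice.Properties.Lattice as LatticeProperties
open import Data.Product using (∃-syntax; _×_; _,_; proj₁; proj₂; swap)
open import Data.Sum as Sum using (_⊎_; inj₁; inj₂; [_,_]′)
open import Function using (_∘_; flip; mk⇔; module Equivalence)
open import Relation.Binary.Bundles using (DecTotalOrder)
open import Relation.Binary.Definitions using (Reflexive; Total; Transitive)
open import Relation.Binary.Lattice using (IsLattice)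
open import Relation.Binary.Construct.Interior.Symmetric as SymInterior using (SymInterior; _,_)
import Relation.Binary.Construct.NaturalOrder.Left as NaturalOrder
import Relation.Binary.Reasoning.PartialOrder as PosetReasoning
open import Relation.Nullary
  using (¬_; yes; no; True; toWitness; fromWitness; contradiction)
open import Relation.Nullary.Decidable using (map′)

open Equivalence using (to; from)

private
  variable
    c ℓ : Level

excludedMiddle-lower : ExcludedMiddle (c ⊔ ℓ) → ExcludedMiddle ℓ
excludedMiddle-lower {c} em = map′ lower lift (em {Lift c _})

-- Chains with a Galois connection.

-- In terms of products, x ≤ y ˡ and y ≤ x ʳ both say x ∙ y ≤ ε.

record GaloisChain (c ℓ : Level) : Set (suc (c ⊔ ℓ)) where
  infix 9 _ʳ _ˡ
  field
    decTotalOrder : DecTotalOrder c ℓ ℓ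

  open DecTotalOrder decTotalOrder public

  field
    ε           : Carrier
    _ʳ _ˡ       : Op₁ Carrier
    galois-to   : ∀ {x y} → x ≤ y ˡ → y ≤ x ʳ
    galois-from : ∀ {x y} → y ≤ x ʳ → x ≤ y ˡ
    εʳ≈ε        : ε ʳ ≈ ε
    εˡ≈ε        : ε ˡ ≈ ε
    -- The hypotheses place x in the interval (`y ˡ`, `y ʳ`], so the conclusion makes x its top:
    -- that interval has at most one element.
    ʳ-covers-ˡ  : ∀ {x y} → x ≤ y ʳ → ¬ (x ≤ y ˡ) → y ʳ ≤ x
    ˡ-covers-ʳ  : ∀ {x y} → x ≤ y ˡ → ¬ (x ≤ y ʳ) → y ˡ ≤ x

  ≰⇒≥ : ∀ {x y} → ¬ (x ≤ y) → y ≤ x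
  ≰⇒≥ {x} {y} x≰y = [ flip contradiction x≰y , (λ y≤x → y≤x) ]′ (total x y)

  ʳ-anti : ∀ {x y} → x ≤ y → y ʳ ≤ x ʳ
  ʳ-anti x≤y = galois-to (trans x≤y (galois-from refl))

  ˡ-anti : ∀ {x y} → x ≤ y → y ˡ ≤ x ˡ
  ˡ-anti x≤y = galois-from (trans x≤y (galois-to refl))

  x≤ε⇒ε≤xʳ : ∀ {x} → x ≤ ε → ε ≤ x ʳ
  x≤ε⇒ε≤xʳ x≤ε = galois-to (trans x≤ε (reflexive (Eq.sym εˡ≈ε)))

  ε≤xʳ⇒x≤ε : ∀ {x} → ε ≤ x ʳ → x ≤ ε
  ε≤xʳ⇒x≤ε ε≤xʳ = trans (galois-from ε≤xʳ) (reflexive εˡ≈ε)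

-- Reversing the product keeps the order and exchanges the two maps. Mirrored facts below are read
-- off from this chain.
opposite : GaloisChain c ℓ → GaloisChain c ℓ
opposite G = record
  { decTotalOrder = decTotalOrder
  ; ε             = ε
  ; _ʳ            = _ˡ
  ; _ˡ            = _ʳ
  ; galois-to     = galois-from
  ; galois-from   = galois-to
  ; εʳ≈ε          = εˡ≈ε
  ; εˡ≈ε          = εʳ≈ε
  ; ʳ-covers-ˡ    = ˡ-covers-ʳ
  ; ˡ-covers-ʳ    = ʳ-covers-ˡ
  }
  where open GaloisChain G

-- The product of a Galois chain, its associativity and its residuals.

module Absorption (G : GaloisChain c ℓ) where
  open GaloisChain G

  -- x ⊲ y encodes x ∙ y ≈ y for the product x ∙ y = (if x ≤ y ˡ then x ∧ y else x ∨ y).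
  _⊲_ : Carrier → Carrier → Set ℓ
  x ⊲ y = (y ≤ x ʳ × y ≤ x) ⊎ (¬ (y ≤ x ʳ) × x ≤ y)

  -- Antitonicity of `_ʳ` settles all but the comparison of x and z in the two mixed cases. There,
  -- if x and z compare the wrong way round, one of them falls between the two residuals of y, and
  -- the covering condition still yields the required comparison.
  ⊲-trans : ∀ {x y z} → x ⊲ y → y ⊲ z → x ⊲ z
  ⊲-trans (inj₁ (y≤xʳ , y≤x)) (inj₁ (z≤yʳ , z≤y)) =
    inj₁ (trans z≤y y≤xʳ , trans z≤y y≤x)
  ⊲-trans (inj₂ (y≰xʳ , x≤y)) (inj₂ (z≰yʳ , y≤z)) =
    inj₂ (y≰xʳ ∘ trans y≤z , trans x≤y y≤z)
  ⊲-trans {x} {y} {z} (inj₁ (y≤xʳ , y≤x)) (inj₂ (z≰yʳ , y≤z)) =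
    inj₂ ((λ z≤xʳ → z≰yʳ (trans z≤xʳ (ʳ-anti y≤x))) , x≤z)
    where
    x≤yˡ = galois-from y≤xʳ

    x≤z : x ≤ z
    x≤z with total x z
    ... | inj₁ x≤z = x≤z
    ... | inj₂ z≤x = trans x≤yˡ (ˡ-covers-ʳ (trans z≤x x≤yˡ) z≰yʳ)
  ⊲-trans {x} {y} {z} (inj₂ (y≰xʳ , x≤y)) (inj₁ (z≤yʳ , z≤y)) =
    inj₁ (trans z≤yʳ (ʳ-anti x≤y) , z≤x)
    where
    z≤x : z ≤ x
    z≤x with total x z
    ... | inj₁ x≤z = trans z≤yʳ (ʳ-covers-ˡ (trans x≤z z≤yʳ) (y≰xʳ ∘ galois-to))
    ... | inj₂ z≤x = z≤x

module Product (G : GaloisChain c ℓ) where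
  open GaloisChain G
  open NaturalMin totalOrder public renaming (_⊓_ to infixr 7 _∧_)
  open NaturalMax totalOrder public renaming (_⊔_ to infixr 6 _∨_)
  open Absorption G public
  open Absorption (opposite G) public using ()
    renaming (_⊲_ to _⊲ᵒ_; ⊲-trans to ⊲ᵒ-trans)
  open AlgebraDefinitions _≈_

  infixl 8 _∙_
  _∙_ : Op₂ Carrier
  x ∙ y with x ≤? y ˡ
  ... | yes _ = x ∧ y
  ... | no  _ = x ∨ y

  ∙-meet : ∀ {x y} → x ≤ y ˡ → x ∙ y ≈ x ∧ y
  ∙-meet {x} {y} x≤yˡ with x ≤? y ˡ
  ... | yes _    = Eq.refl
  ... | no  x≰yˡ = contradiction x≤yˡ x≰yˡ

  ∙-join : ∀ {x y} → ¬ (x ≤ y ˡ) → x ∙ y ≈ x ∨ y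
  ∙-join {x} {y} x≰yˡ with x ≤? y ˡ
  ... | yes x≤yˡ = contradiction x≤yˡ x≰yˡ
  ... | no  _    = Eq.refl

  ⊲⇒∙≈ : ∀ {x y} → x ⊲ y → x ∙ y ≈ y
  ⊲⇒∙≈ (inj₁ (y≤xʳ , y≤x)) = Eq.trans (∙-meet (galois-from y≤xʳ)) (x≤y⇒y⊓x≈x y≤x)
  ⊲⇒∙≈ (inj₂ (y≰xʳ , x≤y)) = Eq.trans (∙-join (y≰xʳ ∘ galois-to)) (x≤y⇒x⊔y≈y x≤y)

  ⊲ᵒ⇒∙≈ : ∀ {x y} → y ⊲ᵒ x → x ∙ y ≈ x
  ⊲ᵒ⇒∙≈ (inj₁ (x≤yˡ , x≤y)) = Eq.trans (∙-meet x≤yˡ) (x≤y⇒x⊓y≈x x≤y)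
  ⊲ᵒ⇒∙≈ (inj₂ (x≰yˡ , y≤x)) = Eq.trans (∙-join x≰yˡ) (x≤y⇒y⊔x≈y y≤x)

  -- A meet or a join in a chain is one of its arguments; the alternative records which factor of
  -- `x ∙ y` survives.
  ⊲-or-⊲ᵒ : ∀ x y → x ⊲ y ⊎ y ⊲ᵒ x
  ⊲-or-⊲ᵒ x y with x ≤? y ˡ | total x y
  ... | yes x≤yˡ | inj₁ x≤y = inj₂ (inj₁ (x≤yˡ , x≤y))
  ... | yes x≤yˡ | inj₂ y≤x = inj₁ (inj₁ (galois-to x≤yˡ , y≤x))
  ... | no  x≰yˡ | inj₁ x≤y = inj₁ (inj₂ (x≰yˡ ∘ galois-from , x≤y))
  ... | no  x≰yˡ | inj₂ y≤x = inj₂ (inj₂ (x≰yˡ , y≤x))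

  ∙-mono-≤ : ∀ {x y u v} → x ≤ y → u ≤ v → x ∙ u ≤ y ∙ v
  ∙-mono-≤ {x} {y} {u} {v} x≤y u≤v with x ≤? u ˡ | y ≤? v ˡ
  ... | yes _    | yes _    = ⊓-mono-≤ x≤y u≤v
  ... | yes _    | no  _    = trans (x⊓y≤x x u) (trans x≤y (x≤x⊔y y v))
  ... | no  x≰uˡ | yes y≤vˡ =
    contradiction (trans x≤y (trans y≤vˡ (ˡ-anti u≤v))) x≰uˡ
  ... | no  _    | no  _    = ⊔-mono-≤ x≤y u≤v

  ∙-cong : Congruent₂ _∙_
  ∙-cong x≈y u≈v = antisym
    (∙-mono-≤ (reflexive x≈y) (reflexive u≈v))
    (∙-mono-≤ (reflexive (Eq.sym x≈y)) (reflexive (Eq.sym u≈v)))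

  ∙-idem : Idempotent _∙_
  ∙-idem x = [ ⊲⇒∙≈ , ⊲ᵒ⇒∙≈ ]′ (⊲-or-⊲ᵒ x x)

  -- Split on the factors that survive in `x ∙ y` and `y ∙ z`. If both absorptions run in the same
  -- direction, transitivity of `_⊲_` or of its dual evaluates `x ∙ z`; otherwise both bracketings
  -- reduce directly.
  ∙-assoc : Associative _∙_
  ∙-assoc x y z with ⊲-or-⊲ᵒ x y | ⊲-or-⊲ᵒ y z
  ... | inj₁ x⊲y | inj₁ y⊲z =
    Eq.trans (∙-cong (⊲⇒∙≈ x⊲y) Eq.refl)
      (Eq.trans (⊲⇒∙≈ y⊲z)
        (Eq.sym (Eq.trans (∙-cong Eq.refl (⊲⇒∙≈ y⊲z)) (⊲⇒∙≈ (⊲-trans x⊲y y⊲z)))))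
  ... | inj₁ x⊲y | inj₂ z⊲y =
    Eq.trans (∙-cong (⊲⇒∙≈ x⊲y) Eq.refl)
      (Eq.trans (⊲ᵒ⇒∙≈ z⊲y)
        (Eq.sym (Eq.trans (∙-cong Eq.refl (⊲ᵒ⇒∙≈ z⊲y)) (⊲⇒∙≈ x⊲y))))
  ... | inj₂ y⊲x | inj₁ y⊲z =
    Eq.trans (∙-cong (⊲ᵒ⇒∙≈ y⊲x) Eq.refl)
      (Eq.sym (∙-cong Eq.refl (⊲⇒∙≈ y⊲z)))
  ... | inj₂ y⊲x | inj₂ z⊲y =
    Eq.trans (∙-cong (⊲ᵒ⇒∙≈ y⊲x) Eq.refl)
      (Eq.trans (⊲ᵒ⇒∙≈ (⊲ᵒ-trans z⊲y y⊲x))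
        (Eq.sym (Eq.trans (∙-cong Eq.refl (⊲ᵒ⇒∙≈ z⊲y)) (⊲ᵒ⇒∙≈ y⊲x))))

  ε⊲ : ∀ y → ε ⊲ y
  ε⊲ y with y ≤? ε
  ... | yes y≤ε = inj₁ (trans y≤ε (reflexive (Eq.sym εʳ≈ε)) , y≤ε)
  ... | no  y≰ε = inj₂ ((λ y≤εʳ → y≰ε (trans y≤εʳ (reflexive εʳ≈ε))) , ≰⇒≥ y≰ε)

  ∙-identityˡ : LeftIdentity ε _∙_
  ∙-identityˡ y = ⊲⇒∙≈ (ε⊲ y)

  infixl 8 _\\_
  _\\_ : Op₂ Carrier
  x \\ z with x ≤? z
  -- If `x ≤ z`, a factor below `x ʳ` gives a meet below x, and a factor below z gives a product
  -- below z. In the other case a join with x is never below z, so the factor must lie below `x ʳ`,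
  -- and the meet is below z only if the factor is.
  ... | yes _ = x ʳ ∨ z
  ... | no  _ = x ʳ ∧ z

  ∙≤⇒≤\\ : ∀ {x y z} → x ∙ y ≤ z → y ≤ x \\ z
  ∙≤⇒≤\\ {x} {y} {z} xy≤z with x ≤? z | x ≤? y ˡ
  ... | yes _   | yes x≤yˡ = trans (galois-to x≤yˡ) (x≤x⊔y (x ʳ) z)
  ... | yes _   | no  _    = trans (x≤y⊔x x y) (trans xy≤z (x≤y⊔x (x ʳ) z))
  ... | no  x≰z | no  _    = contradiction (trans (x≤x⊔y x y) xy≤z) x≰z
  ... | no  x≰z | yes x≤yˡ =
    [ (λ x≤y → contradiction (trans (⊓-glb refl x≤y) xy≤z) x≰z)
    , (λ y≤x → ⊓-glb (galois-to x≤yˡ) (trans (⊓-glb y≤x refl) xy≤z))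
    ]′ (total x y)

  ≤\\⇒∙≤ : ∀ {x y z} → y ≤ x \\ z → x ∙ y ≤ z
  ≤\\⇒∙≤ {x} {y} {z} y≤x\\z with x ≤? z | x ≤? y ˡ
  ... | yes x≤z | yes _    = trans (x⊓y≤x x y) x≤z
  ... | no  _   | yes _    = trans (x⊓y≤y x y) (trans y≤x\\z (x⊓y≤y (x ʳ) z))
  ... | no  _   | no  x≰yˡ =
    contradiction (galois-from (trans y≤x\\z (x⊓y≤x (x ʳ) z))) x≰yˡ
  ... | yes x≤z | no  x≰yˡ =
    [ (λ xʳ≤z → ⊔-lub x≤z (trans y≤x\\z (⊔-lub xʳ≤z refl)))
    , (λ z≤xʳ → contradiction (galois-from (trans y≤x\\z (⊔-lub refl z≤xʳ))) x≰yˡ)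
    ]′ (total (x ʳ) z)

  \\ε≈ʳ : ∀ x → x \\ ε ≈ x ʳ
  \\ε≈ʳ x with x ≤? ε
  ... | yes x≤ε = x≤y⇒y⊔x≈y (x≤ε⇒ε≤xʳ x≤ε)
  ... | no  x≰ε = x≤y⇒x⊓y≈x (≰⇒≥ (x≰ε ∘ ε≤xʳ⇒x≤ε))

-- From Galois chains to idempotent residuated chains.

module FromGaloisChain (G : GaloisChain c ℓ) where
  open GaloisChain G
  open Product G
  private module Pᵒ = Product (opposite G)

  -- The same factor survives in both chains, since `_⊲_` and `_⊲ᵒ_` trade places. This lets the
  -- residual built in the opposite chain serve as `_//_`.
  ∙ᵒ≈∙ : ∀ x y → y Pᵒ.∙ x ≈ x ∙ y
  ∙ᵒ≈∙ x y with ⊲-or-⊲ᵒ x y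
  ... | inj₁ x⊲y = Eq.trans (Pᵒ.⊲ᵒ⇒∙≈ x⊲y) (Eq.sym (⊲⇒∙≈ x⊲y))
  ... | inj₂ y⊲x = Eq.trans (Pᵒ.⊲⇒∙≈ y⊲x) (Eq.sym (⊲ᵒ⇒∙≈ y⊲x))

  ≤⇒≈∧ : ∀ {x y} → x ≤ y → x ≈ x ∧ y
  ≤⇒≈∧ = Eq.sym ∘ x≤y⇒x⊓y≈x

  ≈∧⇒≤ : ∀ {x y} → x ≈ x ∧ y → x ≤ y
  ≈∧⇒≤ = x⊓y≈x⇒x≤y ∘ Eq.sym

  residuatedLattice : ResiduatedLattice c ℓ
  residuatedLattice = record
    { Carrier = Carrier
    ; _≈_     = _≈_
    ; _∨_     = _∨_
    ; _∧_     = _∧_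
    ; _∙_     = _∙_
    ; _\\_    = _\\_
    ; _//_    = flip Pᵒ._\\_
    ; ε       = ε
    ; isResiduatedLattice = record
      { isLattice   = MinMaxLattice.⊔-⊓-isLattice minOperator maxOperator
      ; ∙-cong      = ∙-cong
      ; ∙-assoc     = ∙-assoc
      ; ∙-identity  = ∙-identityˡ , λ x → Eq.trans (Eq.sym (∙ᵒ≈∙ x ε)) (Pᵒ.∙-identityˡ x)
      ; \\-residual = λ x y z → mk⇔
          (≤⇒≈∧ ∘ ≤\\⇒∙≤ ∘ ≈∧⇒≤)
          (≤⇒≈∧ ∘ ∙≤⇒≤\\ ∘ ≈∧⇒≤)
      ; //-residual = λ x y z → mk⇔
          (≤⇒≈∧ ∘ Pᵒ.∙≤⇒≤\\ ∘ trans (reflexive (∙ᵒ≈∙ x y)) ∘ ≈∧⇒≤)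
          (≤⇒≈∧ ∘ trans (reflexive (Eq.sym (∙ᵒ≈∙ x y))) ∘ Pᵒ.≤\\⇒∙≤ ∘ ≈∧⇒≤)
      }
    }

  isIdempotentResiduatedChain : IsIdempotentResiduatedChain residuatedLattice
  isIdempotentResiduatedChain = record
    { ≤-total = λ x y → [ inj₁ ∘ ≤⇒≈∧ , inj₂ ∘ ≤⇒≈∧ ]′ (total x y)
    ; ∙-idem  = ∙-idem
    }

-- Arithmetic of idempotent residuated chains.

oppositeLattice : ResiduatedLattice c ℓ → ResiduatedLattice c ℓ
oppositeLattice A = record
  { Carrier = Carrier
  ; _≈_     = _≈_
  ; _∨_     = _∨_
  ; _∧_     = _∧_
  ; _∙_     = flip _∙_
  ; _\\_    = flip _//_
  ; _//_    = flip _\\_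
  ; ε       = ε
  ; isResiduatedLattice = record
    { isLattice   = isLattice
    ; ∙-cong      = flip ∙-cong
    ; ∙-assoc     = λ x y z → sym (∙-assoc z y x)
    ; ∙-identity  = swap ∙-identity
    ; \\-residual = λ x y z → mk⇔ (from (//-residual y x z)) (to (//-residual y x z))
    ; //-residual = λ x y z → mk⇔ (from (\\-residual y x z)) (to (\\-residual y x z))
    }
  }
  where open ResiduatedLattice A

opposite-isIdempotentResiduatedChain :
  {A : ResiduatedLattice c ℓ} →
  IsIdempotentResiduatedChain A → IsIdempotentResiduatedChain (oppositeLattice A)
opposite-isIdempotentResiduatedChain K = record
  { ≤-total = ≤-total ; ∙-idem = ∙-idem }
  where open IsIdempotentResiduatedChain K

module ChainProperties {A : ResiduatedLattice c ℓ} (K : IsIdempotentResiduatedChain A) where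
  open ResiduatedLattice A public
  open IsIdempotentResiduatedChain K public
  open LatticeProperties lattice public
    using (∧-isSemilattice; poset; ∨-∧-isOrderTheoreticLattice)
  open IsLattice ∨-∧-isOrderTheoreticLattice public
    using (x≤x∨y; y≤x∨y; ∨-least; x∧y≤x; x∧y≤y; ∧-greatest)
    renaming (refl to ≤-refl; reflexive to ≤-reflexive; trans to ≤-trans; antisym to ≤-antisym)
  open PosetReasoning poset

  \\-to : ∀ {x y z} → y ≤ x \\ z → x ∙ y ≤ z
  \\-to = to (\\-residual _ _ _)

  \\-from : ∀ {x y z} → x ∙ y ≤ z → y ≤ x \\ z
  \\-from = from (\\-residual _ _ _)

  //-to : ∀ {x y z} → x ∙ y ≤ z → x ≤ z // y
  //-to = to (//-residual _ _ _)

  //-from : ∀ {x y z} → x ≤ z // y → x ∙ y ≤ z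
  //-from = from (//-residual _ _ _)

  ∙-monoʳ-≤ : ∀ x {y z} → y ≤ z → x ∙ y ≤ x ∙ z
  ∙-monoʳ-≤ x y≤z = \\-to (≤-trans y≤z (\\-from ≤-refl))

  ∙-monoˡ-≤ : ∀ x {y z} → y ≤ z → y ∙ x ≤ z ∙ x
  ∙-monoˡ-≤ x y≤z = //-from (≤-trans y≤z (//-to ≤-refl))

  ∙-mono-≤ : ∀ {x y u v} → x ≤ y → u ≤ v → x ∙ u ≤ y ∙ v
  ∙-mono-≤ x≤y u≤v = ≤-trans (∙-monoˡ-≤ _ x≤y) (∙-monoʳ-≤ _ u≤v)

  x∙xy≈xy : ∀ x y → x ∙ (x ∙ y) ≈ x ∙ y
  x∙xy≈xy x y = trans (sym (∙-assoc x x y)) (∙-cong (∙-idem x) refl)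

  xy∙y≈xy : ∀ x y → (x ∙ y) ∙ y ≈ x ∙ y
  xy∙y≈xy x y = trans (∙-assoc x y y) (∙-cong refl (∙-idem y))

  ∙-glb : ∀ {x y z} → z ≤ x → z ≤ y → z ≤ x ∙ y
  ∙-glb z≤x z≤y = ≤-trans (≤-reflexive (sym (∙-idem _))) (∙-mono-≤ z≤x z≤y)

  ∙-lub : ∀ {x y z} → x ≤ z → y ≤ z → x ∙ y ≤ z
  ∙-lub x≤z y≤z = ≤-trans (∙-mono-≤ x≤z y≤z) (≤-reflexive (∙-idem _))

  -- Multiplying the hypothesis by x on the left or by y on the right and absorbing the repeated
  -- factor bounds the product by each factor. Idempotence puts every common lower bound below the
  -- product.
  xy≤ε⇒xy≈x∧y : ∀ {x y} → x ∙ y ≤ ε → x ∙ y ≈ x ∧ y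
  xy≤ε⇒xy≈x∧y {x} {y} xy≤ε = ≤-antisym (∧-greatest xy≤x xy≤y) (∙-glb (x∧y≤x x y) (x∧y≤y x y))
    where
    xy≤x : x ∙ y ≤ x
    xy≤x = begin
      x ∙ y       ≈⟨ x∙xy≈xy x y ⟨
      x ∙ (x ∙ y) ≤⟨ ∙-monoʳ-≤ x xy≤ε ⟩
      x ∙ ε       ≈⟨ proj₂ ∙-identity x ⟩
      x           ∎

    xy≤y : x ∙ y ≤ y
    xy≤y = begin
      x ∙ y       ≈⟨ xy∙y≈xy x y ⟨
      (x ∙ y) ∙ y ≤⟨ ∙-monoˡ-≤ y xy≤ε ⟩
      ε ∙ y       ≈⟨ proj₁ ∙-identity y ⟩
      y           ∎

  -- The same absorption with the inequalities reversed. In a chain one of the two lemmas always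
  -- applies, so the side of ε decides whether a product is a meet or a join.
  ε≤xy⇒xy≈x∨y : ∀ {x y} → ε ≤ x ∙ y → x ∙ y ≈ x ∨ y
  ε≤xy⇒xy≈x∨y {x} {y} ε≤xy = ≤-antisym (∙-lub (x≤x∨y x y) (y≤x∨y x y)) (∨-least x≤xy y≤xy)
    where
    x≤xy : x ≤ x ∙ y
    x≤xy = begin
      x           ≈⟨ proj₂ ∙-identity x ⟨
      x ∙ ε       ≤⟨ ∙-monoʳ-≤ x ε≤xy ⟩
      x ∙ (x ∙ y) ≈⟨ x∙xy≈xy x y ⟩
      x ∙ y       ∎

    y≤xy : y ≤ x ∙ y
    y≤xy = begin
      y           ≈⟨ proj₁ ∙-identity y ⟨
      ε ∙ y       ≤⟨ ∙-monoˡ-≤ y ε≤xy ⟩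
      (x ∙ y) ∙ y ≈⟨ xy∙y≈xy x y ⟩
      x ∙ y       ∎

  xxʳ≤ε : ∀ x → x ∙ x ʳ ≤ ε
  xxʳ≤ε x = \\-to ≤-refl

  -- Here `x ∙ y` is at least ε, hence a join, while `y ∙ y ʳ` is a meet. Bracketing `x ∙ y ∙ y ʳ`
  -- in the two ways pushes `y ʳ` below x.
  ʳ-covers-ˡ : ∀ {x y} → x ≤ y ʳ → ¬ (x ≤ y ˡ) → y ʳ ≤ x
  ʳ-covers-ˡ {x} {y} x≤yʳ x≰yˡ with ≤-total (x ∙ y) ε
  ... | inj₁ xy≤ε = contradiction (//-to xy≤ε) x≰yˡ
  ... | inj₂ ε≤xy = [ case-y≤x , case-x≤y ]′ (≤-total y x)
    where
    xy≈x∨y = ε≤xy⇒xy≈x∨y ε≤xy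
    yyʳ≈y∧yʳ = xy≤ε⇒xy≈x∧y (xxʳ≤ε y)

    case-y≤x : y ≤ x → y ʳ ≤ x
    case-y≤x y≤x = begin
      y ʳ             ≤⟨ y≤x∨y x (y ʳ) ⟩
      x ∨ y ʳ         ≈⟨ ε≤xy⇒xy≈x∨y (≤-trans ε≤xy (∙-monoʳ-≤ x y≤yʳ)) ⟨
      x ∙ y ʳ         ≤⟨ ∙-monoˡ-≤ (y ʳ) (≤-trans (x≤x∨y x y) (≤-reflexive (sym xy≈x∨y))) ⟩
      (x ∙ y) ∙ y ʳ   ≈⟨ ∙-assoc x y (y ʳ) ⟩
      x ∙ (y ∙ y ʳ)   ≤⟨ ∙-monoʳ-≤ x (≤-trans (≤-reflexive yyʳ≈y∧yʳ) (x∧y≤x y (y ʳ))) ⟩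
      x ∙ y           ≤⟨ ∙-lub ≤-refl y≤x ⟩
      x               ∎
      where y≤yʳ = ≤-trans y≤x x≤yʳ

    case-x≤y : x ≤ y → y ʳ ≤ x
    case-x≤y x≤y with ≤-total y (y ʳ)
    ... | inj₁ y≤yʳ = contradiction (//-to xy≤ε) x≰yˡ
      where
      xy≤ε : x ∙ y ≤ ε
      xy≤ε = begin
        x ∙ y   ≤⟨ ∙-lub x≤y ≤-refl ⟩
        y       ≤⟨ ∙-glb ≤-refl y≤yʳ ⟩
        y ∙ y ʳ ≤⟨ xxʳ≤ε y ⟩
        ε       ∎
    ... | inj₂ yʳ≤y = begin
      y ʳ           ≤⟨ ∙-glb yʳ≤y ≤-refl ⟩
      y ∙ y ʳ       ≤⟨ ∙-monoˡ-≤ (y ʳ) (≤-trans (y≤x∨y x y) (≤-reflexive (sym xy≈x∨y))) ⟩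
      (x ∙ y) ∙ y ʳ ≈⟨ ∙-assoc x y (y ʳ) ⟩
      x ∙ (y ∙ y ʳ) ≤⟨ ∙-monoʳ-≤ x (≤-trans (≤-reflexive yyʳ≈y∧yʳ) (x∧y≤y y (y ʳ))) ⟩
      x ∙ y ʳ       ≈⟨ xy≤ε⇒xy≈x∧y (≤-trans (∙-monoˡ-≤ (y ʳ) x≤y) (xxʳ≤ε y)) ⟩
      x ∧ y ʳ       ≤⟨ x∧y≤x x (y ʳ) ⟩
      x             ∎

  x≤z⇒x\\z≈xʳ∨z : ∀ {x z} → x ≤ z → x \\ z ≈ x ʳ ∨ z
  x≤z⇒x\\z≈xʳ∨z {x} {z} x≤z = ≤-antisym (below ≤-refl) (∨-least xʳ≤x\\z z≤x\\z)
    where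
    z≤x\\z = \\-from (∙-lub x≤z ≤-refl)

    xʳ≤x\\z : x ʳ ≤ x \\ z
    xʳ≤x\\z = \\-from (≤-trans
      (≤-reflexive (xy≤ε⇒xy≈x∧y (xxʳ≤ε x))) (≤-trans (x∧y≤x x (x ʳ)) x≤z))

    -- If `x ∙ w ≤ ε`, then w is below `x ʳ`; otherwise `x ∙ w` is a join, and its bound z also
    -- bounds w.
    below : ∀ {w} → w ≤ x \\ z → w ≤ x ʳ ∨ z
    below {w} w≤x\\z with ≤-total (x ∙ w) ε
    ... | inj₁ xw≤ε = ≤-trans (\\-from xw≤ε) (x≤x∨y (x ʳ) z)
    ... | inj₂ ε≤xw = begin
      w       ≤⟨ y≤x∨y x w ⟩
      x ∨ w   ≈⟨ ε≤xy⇒xy≈x∨y ε≤xw ⟨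
      x ∙ w   ≤⟨ \\-to w≤x\\z ⟩
      z       ≤⟨ y≤x∨y (x ʳ) z ⟩
      x ʳ ∨ z ∎

  x≰z⇒x\\z≈xʳ∧z : ∀ {x z} → ¬ (x ≤ z) → x \\ z ≈ x ʳ ∧ z
  x≰z⇒x\\z≈xʳ∧z {x} {z} x≰z = ≤-antisym (below ≤-refl) (\\-from xv≤z)
    where
    v = x ʳ ∧ z

    xv≤z : x ∙ v ≤ z
    xv≤z = begin
      x ∙ v ≈⟨ xy≤ε⇒xy≈x∧y (≤-trans (∙-monoʳ-≤ x (x∧y≤x (x ʳ) z)) (xxʳ≤ε x)) ⟩
      x ∧ v ≤⟨ x∧y≤y x v ⟩
      v     ≤⟨ x∧y≤y (x ʳ) z ⟩
      z     ∎

    below : ∀ {w} → w ≤ x \\ z → w ≤ v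
    below {w} w≤x\\z with ≤-total (x ∙ w) ε | ≤-total x w
    ... | _ | inj₁ x≤w =
      contradiction (≤-trans (∙-glb ≤-refl x≤w) (\\-to w≤x\\z)) x≰z
    ... | inj₁ xw≤ε | inj₂ w≤x =
      ∧-greatest (\\-from xw≤ε) (≤-trans (∙-glb w≤x ≤-refl) (\\-to w≤x\\z))
    ... | inj₂ ε≤xw | inj₂ w≤x = contradiction
      (≤-trans (x≤x∨y x w) (≤-trans (≤-reflexive (sym (ε≤xy⇒xy≈x∨y ε≤xw))) (\\-to w≤x\\z))) x≰z

  \\-congˡ : ∀ {x y z} → y ≈ z → x \\ y ≈ x \\ z
  \\-congˡ y≈z = ≤-antisym
    (\\-from (≤-trans (\\-to ≤-refl) (≤-reflexive y≈z)))
    (\\-from (≤-trans (\\-to ≤-refl) (≤-reflexive (sym y≈z))))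

  //-congʳ : ∀ {x y z} → y ≈ z → y // x ≈ z // x
  //-congʳ y≈z = ≤-antisym
    (//-to (≤-trans (//-from ≤-refl) (≤-reflexive y≈z)))
    (//-to (≤-trans (//-from ≤-refl) (≤-reflexive (sym y≈z))))

  ʳ-anti : ∀ {x y} → x ≤ y → y ʳ ≤ x ʳ
  ʳ-anti {x} {y} x≤y = \\-from (≤-trans (∙-monoˡ-≤ (y ʳ) x≤y) (xxʳ≤ε y))

  ˡ-anti : ∀ {x y} → x ≤ y → y ˡ ≤ x ˡ
  ˡ-anti {x} {y} x≤y = //-to (≤-trans (∙-monoʳ-≤ (y ˡ) x≤y) (//-from ≤-refl))

  εʳ≈ε : ε ʳ ≈ ε
  εʳ≈ε = ≤-antisym
    (≤-trans (≤-reflexive (sym (proj₁ ∙-identity (ε ʳ)))) (xxʳ≤ε ε))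
    (\\-from (≤-reflexive (∙-idem ε)))

  ʳ-cong : ∀ {x y} → x ≈ y → x ʳ ≈ y ʳ
  ʳ-cong x≈y = ≤-antisym (ʳ-anti (≤-reflexive (sym x≈y))) (ʳ-anti (≤-reflexive x≈y))

  ˡ-cong : ∀ {x y} → x ≈ y → x ˡ ≈ y ˡ
  ˡ-cong x≈y = ≤-antisym (ˡ-anti (≤-reflexive (sym x≈y))) (ˡ-anti (≤-reflexive x≈y))

  ⋆-cong : ∀ {x y} → x ≈ y → x ⋆ ≈ y ⋆
  ⋆-cong x≈y = ∧-cong (ˡ-cong x≈y) (ʳ-cong x≈y)

  ⋆-sel : ∀ x → x ⋆ ≈ x ʳ ⊎ x ⋆ ≈ x ˡ
  ⋆-sel x with ≤-total (x ˡ) (x ʳ)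
  ... | inj₁ xˡ≤xʳ = inj₂ (sym xˡ≤xʳ)
  ... | inj₂ xʳ≤xˡ = inj₁ (trans (∧-comm (x ˡ) (x ʳ)) (sym xʳ≤xˡ))

-- From residuated chains to Galois chains, and the effect of ⋆-involutivity.

module ToGaloisChain
  (em : ExcludedMiddle ℓ) {A : ResiduatedLattice c ℓ} (K : IsIdempotentResiduatedChain A) where
  open ChainProperties K
  private module Kᵒ = ChainProperties (opposite-isIdempotentResiduatedChain K)

  galoisChain : GaloisChain c ℓ
  galoisChain = record
    { decTotalOrder = record
      { isDecTotalOrder = record
        { isTotalOrder = record
          { isPartialOrder = NaturalOrder.isPartialOrder _≈_ _∧_ ∧-isSemilattice
          ; total          = ≤-total
          }
        ; _≟_  = λ _ _ → em
        ; _≤?_ = λ _ _ → em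
        }
      }
    ; ε           = ε
    ; _ʳ          = _ʳ
    ; _ˡ          = _ˡ
    ; galois-to   = \\-from ∘ //-from
    ; galois-from = //-to ∘ \\-to
    ; εʳ≈ε        = εʳ≈ε
    ; εˡ≈ε        = Kᵒ.εʳ≈ε
    ; ʳ-covers-ˡ  = ʳ-covers-ˡ
    ; ˡ-covers-ʳ  = Kᵒ.ʳ-covers-ˡ
    }

module _ (em : ExcludedMiddle ℓ) {A : ResiduatedLattice c ℓ}
         (K : Is⋆InvolutiveIdempotentResiduatedChain A) where
  open Is⋆InvolutiveIdempotentResiduatedChain K
  open ChainProperties isIdempotentResiduatedChain hiding (≤-total; ∙-idem; ʳ-covers-ˡ)
  open GaloisChain (ToGaloisChain.galoisChain em isIdempotentResiduatedChain)
    using (galois-to; galois-from; ʳ-covers-ˡ; ˡ-covers-ʳ; ≰⇒≥; _≤?_)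

  ⋆-recovers : ∀ {x y} → x ⋆ ≈ y → x ≈ y ʳ ⊎ x ≈ y ˡ
  ⋆-recovers {x} {y} x⋆≈y =
    [ inj₁ ∘ trans x≈y⋆ , inj₂ ∘ trans x≈y⋆ ]′ (⋆-sel y)
    where
    x≈y⋆ = trans (sym (⋆-involutive x)) (⋆-cong x⋆≈y)

  -- If `x ʳ` is the smaller residual, it is `x ⋆` and involutivity recovers x. Otherwise x lies
  -- above `(x ʳ) ʳ` and below `(x ʳ) ˡ`, and the covering condition makes it equal to the latter.
  ʳ-recovers : ∀ x → x ≈ (x ʳ) ʳ ⊎ x ≈ (x ʳ) ˡ
  ʳ-recovers x with x ʳ ≤? x ˡ
  ... | yes xʳ≤xˡ = ⋆-recovers (trans (∧-comm (x ˡ) (x ʳ)) (sym xʳ≤xˡ))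
  ... | no  xʳ≰xˡ = inj₂ (≤-antisym x≤xʳˡ (ˡ-covers-ʳ x≤xʳˡ (xʳ≰xˡ ∘ galois-from)))
    where x≤xʳˡ = galois-from ≤-refl

  ˡ-recovers : ∀ x → x ≈ (x ˡ) ʳ ⊎ x ≈ (x ˡ) ˡ
  ˡ-recovers x with x ˡ ≤? x ʳ
  ... | yes xˡ≤xʳ = ⋆-recovers (sym xˡ≤xʳ)
  ... | no  xˡ≰xʳ = inj₁ (≤-antisym x≤xˡʳ (ʳ-covers-ˡ x≤xˡʳ (xˡ≰xʳ ∘ galois-to)))
    where x≤xˡʳ = galois-to ≤-refl

-- Embeddings of Galois chains and fullness.

module _ (A B : GaloisChain c ℓ) where
  private
    module A = GaloisChain A
    module B = GaloisChain B

  record GaloisEmbedding : Set (c ⊔ ℓ) where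
    field
      ⟦_⟧    : A.Carrier → B.Carrier
      mono   : ∀ {x y} → x A.≤ y → ⟦ x ⟧ B.≤ ⟦ y ⟧
      cancel : ∀ {x y} → ⟦ x ⟧ B.≤ ⟦ y ⟧ → x A.≤ y
      ε-homo : ⟦ A.ε ⟧ B.≈ B.ε
      ʳ-homo : ∀ x → ⟦ x A.ʳ ⟧ B.≈ ⟦ x ⟧ B.ʳ
      ˡ-homo : ∀ x → ⟦ x A.ˡ ⟧ B.≈ ⟦ x ⟧ B.ˡ

    ⟦⟧-cong : ∀ {x y} → x A.≈ y → ⟦ x ⟧ B.≈ ⟦ y ⟧
    ⟦⟧-cong x≈y = B.antisym
      (mono (A.reflexive x≈y)) (mono (A.reflexive (A.Eq.sym x≈y)))

    InImage : B.Carrier → Set (c ⊔ ℓ)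
    InImage b = ∃[ a ] ⟦ a ⟧ B.≈ b

-- Used in contrapositive form: an element outside the image has both residuals outside it. The
-- gluing order and its Galois connection draw on ⋆-involutivity through this condition.
record IsFull {A B : GaloisChain c ℓ} (f : GaloisEmbedding A B) : Set (c ⊔ ℓ) where
  open GaloisChain B
  open GaloisEmbedding f
  field
    ʳ-reflects : ∀ {b} → InImage (b ʳ) → InImage b
    ˡ-reflects : ∀ {b} → InImage (b ˡ) → InImage b

module _ {A B : GaloisChain c ℓ} where

  oppositeEmbedding : GaloisEmbedding A B → GaloisEmbedding (opposite A) (opposite B)
  oppositeEmbedding f = record
    { ⟦_⟧    = ⟦_⟧
    ; mono   = mono
    ; cancel = cancel
    ; ε-homo = ε-homo
    ; ʳ-homo = ˡ-homo
    ; ˡ-homo = ʳ-homo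
    }
    where open GaloisEmbedding f

  opposite-isFull : {f : GaloisEmbedding A B} → IsFull f → IsFull (oppositeEmbedding f)
  opposite-isFull full = record { ʳ-reflects = ˡ-reflects ; ˡ-reflects = ʳ-reflects }
    where open IsFull full

module EmbeddingProperties
  {A B : GaloisChain c ℓ} {f : GaloisEmbedding A B} (full : IsFull f) where
  private module A = GaloisChain A
  open GaloisChain B
  open GaloisEmbedding f
  open IsFull full

  ε≤⟦ε⟧ : ε ≤ ⟦ A.ε ⟧
  ε≤⟦ε⟧ = reflexive (Eq.sym ε-homo)

  ⟦ε⟧≤ε : ⟦ A.ε ⟧ ≤ ε
  ⟦ε⟧≤ε = reflexive ε-homo

  ≤⟦⟧⇒⟦ʳ⟧≤ʳ : ∀ {a b} → b ≤ ⟦ a ⟧ → ⟦ a A.ʳ ⟧ ≤ b ʳ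
  ≤⟦⟧⇒⟦ʳ⟧≤ʳ b≤a = trans (reflexive (ʳ-homo _)) (ʳ-anti b≤a)

  ⟦⟧≤⇒ʳ≤⟦ʳ⟧ : ∀ {a b} → ⟦ a ⟧ ≤ b → b ʳ ≤ ⟦ a A.ʳ ⟧
  ⟦⟧≤⇒ʳ≤⟦ʳ⟧ a≤b = trans (ʳ-anti a≤b) (reflexive (Eq.sym (ʳ-homo _)))

  ⟦⟧≤ʳ⇒≤⟦ˡ⟧ : ∀ {a b} → ⟦ a ⟧ ≤ b ʳ → b ≤ ⟦ a A.ˡ ⟧
  ⟦⟧≤ʳ⇒≤⟦ˡ⟧ a≤bʳ = trans (galois-from a≤bʳ) (reflexive (Eq.sym (ˡ-homo _)))

  ≤⟦ˡ⟧⇒⟦⟧≤ʳ : ∀ {a b} → b ≤ ⟦ a A.ˡ ⟧ → ⟦ a ⟧ ≤ b ʳ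
  ≤⟦ˡ⟧⇒⟦⟧≤ʳ b≤aˡ = galois-to (trans b≤aˡ (reflexive (ˡ-homo _)))

  module _ {b : Carrier} (b∉f : ¬ InImage b) where

    ʳ-notBoth : ∀ {a} → ⟦ a ⟧ ≤ b ʳ → ¬ (b ʳ ≤ ⟦ a ⟧)
    ʳ-notBoth a≤bʳ bʳ≤a = b∉f (ʳ-reflects (_ , antisym a≤bʳ bʳ≤a))

    ˡ-notBoth : ∀ {a} → ⟦ a ⟧ ≤ b ˡ → ¬ (b ˡ ≤ ⟦ a ⟧)
    ˡ-notBoth a≤bˡ bˡ≤a = b∉f (ˡ-reflects (_ , antisym a≤bˡ bˡ≤a))

    -- By the covering condition an image point in (`b ˡ`, `b ʳ`] would be `b ʳ` itself, which
    -- fullness keeps outside the image.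
    ⟦⟧≤ʳ⇒⟦⟧≤ˡ : ∀ {a} → ⟦ a ⟧ ≤ b ʳ → ⟦ a ⟧ ≤ b ˡ
    ⟦⟧≤ʳ⇒⟦⟧≤ˡ {a} a≤bʳ with ⟦ a ⟧ ≤? b ˡ
    ... | yes a≤bˡ = a≤bˡ
    ... | no  a≰bˡ = contradiction (ʳ-covers-ˡ a≤bʳ a≰bˡ) (ʳ-notBoth a≤bʳ)

    ˡ≤⟦⟧⇒ʳ≤⟦⟧ : ∀ {a} → b ˡ ≤ ⟦ a ⟧ → b ʳ ≤ ⟦ a ⟧
    ˡ≤⟦⟧⇒ʳ≤⟦⟧ {a} bˡ≤a with total ⟦ a ⟧ (b ʳ)
    ... | inj₁ a≤bʳ = contradiction bˡ≤a (ˡ-notBoth (⟦⟧≤ʳ⇒⟦⟧≤ˡ a≤bʳ))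
    ... | inj₂ bʳ≤a = bʳ≤a

-- The gluing order between two extensions.

-- b ↗ c and c ↖ b are witnessed by an element of A lying in between.  If there is
-- none either way, b and c fill the same cut of A, and b goes below c exactly when b ≤ ε.

module Amalgam
  (em : ExcludedMiddle (c ⊔ ℓ)) {A B C : GaloisChain c ℓ}
  {f : GaloisEmbedding A B} {g : GaloisEmbedding A C}
  (f-full : IsFull f) (g-full : IsFull g) where

  private
    module A  = GaloisChain A
    module B  = GaloisChain B
    module C  = GaloisChain C
    module f  = GaloisEmbedding f
    module g  = GaloisEmbedding g
    module fP = EmbeddingProperties f-full
    module gP = EmbeddingProperties g-full

  _↗_ : B.Carrier → C.Carrier → Set (c ⊔ ℓ)
  b ↗ c = ∃[ a ] b B.≤ f.⟦ a ⟧ × g.⟦ a ⟧ C.≤ c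

  _↖_ : C.Carrier → B.Carrier → Set (c ⊔ ℓ)
  c ↖ b = ∃[ a ] c C.≤ g.⟦ a ⟧ × f.⟦ a ⟧ B.≤ b

  _⊑_ : B.Carrier → C.Carrier → Set (c ⊔ ℓ)
  b ⊑ c = b ↗ c ⊎ (¬ (c ↖ b) × b B.≤ B.ε)

  _⊒_ : C.Carrier → B.Carrier → Set (c ⊔ ℓ)
  c ⊒ b = c ↖ b ⊎ (¬ (b ↗ c) × ¬ (b B.≤ B.ε))

  ↗↖⇒≤ : ∀ {b c b′} → b ↗ c → c ↖ b′ → b B.≤ b′
  ↗↖⇒≤ (a , b≤a , a≤c) (a′ , c≤a′ , a′≤b′) =
    B.trans b≤a (B.trans (f.mono (g.cancel (C.trans a≤c c≤a′))) a′≤b′)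

  ↖↗⇒≤ : ∀ {c b c′} → c ↖ b → b ↗ c′ → c C.≤ c′
  ↖↗⇒≤ (a , c≤a , a≤b) (a′ , b≤a′ , a′≤c′) =
    C.trans c≤a (C.trans (g.mono (f.cancel (B.trans a≤b b≤a′))) a′≤c′)

  ↗-↗̸⇒≤ : ∀ {b c b′} → b ↗ c → ¬ (b′ ↗ c) → b B.≤ b′
  ↗-↗̸⇒≤ (a , b≤a , a≤c) b′↗̸c = B.trans b≤a (B.≰⇒≥ λ b′≤a → b′↗̸c (a , b′≤a , a≤c))

  ↖-↖̸⇒≤ : ∀ {c b c′} → c ↖ b → ¬ (c′ ↖ b) → c C.≤ c′
  ↖-↖̸⇒≤ (a , c≤a , a≤b) c′↖̸b = C.trans c≤a (C.≰⇒≥ λ c′≤a → c′↖̸b (a , c′≤a , a≤b))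

  ↖̸-↖⇒≤ : ∀ {b c b′} → ¬ (c ↖ b) → c ↖ b′ → b B.≤ b′
  ↖̸-↖⇒≤ c↖̸b (a , c≤a , a≤b′) = B.trans (B.≰⇒≥ λ a≤b → c↖̸b (a , c≤a , a≤b)) a≤b′

  ↗̸-↗⇒≤ : ∀ {c b c′} → ¬ (b ↗ c) → b ↗ c′ → c C.≤ c′
  ↗̸-↗⇒≤ b↗̸c (a , b≤a , a≤c′) = C.trans (C.≰⇒≥ λ a≤c → b↗̸c (a , b≤a , a≤c)) a≤c′

  ⊑-total : ∀ b c → b ⊑ c ⊎ c ⊒ b
  ⊑-total b c with b B.≤? B.ε
  ... | yes b≤ε with em {c ↖ b}
  ...   | yes c↖b = inj₂ (inj₁ c↖b)
  ...   | no  c↖̸b = inj₁ (inj₂ (c↖̸b , b≤ε))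
  ⊑-total b c | no b≰ε with em {b ↗ c}
  ...   | yes b↗c = inj₁ (inj₁ b↗c)
  ...   | no  b↗̸c = inj₂ (inj₂ (b↗̸c , b≰ε))

  ≤-⊑-trans : ∀ {b b′ c} → b B.≤ b′ → b′ ⊑ c → b ⊑ c
  ≤-⊑-trans b≤b′ (inj₁ (a , b′≤a , a≤c)) = inj₁ (a , B.trans b≤b′ b′≤a , a≤c)
  ≤-⊑-trans b≤b′ (inj₂ (c↖̸b′ , b′≤ε)) =
    inj₂ ((λ (a , c≤a , a≤b) → c↖̸b′ (a , c≤a , B.trans a≤b b≤b′)) , B.trans b≤b′ b′≤ε)

  ⊑-≤-trans : ∀ {b c c′} → b ⊑ c → c C.≤ c′ → b ⊑ c′
  ⊑-≤-trans (inj₁ (a , b≤a , a≤c)) c≤c′ = inj₁ (a , b≤a , C.trans a≤c c≤c′)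
  ⊑-≤-trans (inj₂ (c↖̸b , b≤ε)) c≤c′ =
    inj₂ ((λ (a , c′≤a , a≤b) → c↖̸b (a , C.trans c≤c′ c′≤a , a≤b)) , b≤ε)

  ≤-⊒-trans : ∀ {c c′ b} → c C.≤ c′ → c′ ⊒ b → c ⊒ b
  ≤-⊒-trans c≤c′ (inj₁ (a , c′≤a , a≤b)) = inj₁ (a , C.trans c≤c′ c′≤a , a≤b)
  ≤-⊒-trans c≤c′ (inj₂ (b↗̸c′ , b≰ε)) =
    inj₂ ((λ (a , b≤a , a≤c) → b↗̸c′ (a , b≤a , C.trans a≤c c≤c′)) , b≰ε)

  ⊒-≤-trans : ∀ {c b b′} → c ⊒ b → b B.≤ b′ → c ⊒ b′
  ⊒-≤-trans (inj₁ (a , c≤a , a≤b)) b≤b′ = inj₁ (a , c≤a , B.trans a≤b b≤b′)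
  ⊒-≤-trans (inj₂ (b↗̸c , b≰ε)) b≤b′ =
    inj₂ ((λ (a , b′≤a , a≤c) → b↗̸c (a , B.trans b≤b′ b′≤a , a≤c)) , b≰ε ∘ B.trans b≤b′)

  -- Two witnesses compose in A. A single witness separates `b` from `b′`, because the other
  -- comparison denies that it lies on the wrong side. If both comparisons come from the tie rule, ε
  -- separates them.
  ⊑-⊒-trans : ∀ {b c b′} → b ⊑ c → c ⊒ b′ → b B.≤ b′
  ⊑-⊒-trans (inj₁ b↗c)         (inj₁ c↖b′)         = ↗↖⇒≤ b↗c c↖b′
  ⊑-⊒-trans (inj₁ b↗c)         (inj₂ (b′↗̸c , _))   = ↗-↗̸⇒≤ b↗c b′↗̸c
  ⊑-⊒-trans (inj₂ (c↖̸b , _))   (inj₁ c↖b′)         = ↖̸-↖⇒≤ c↖̸b c↖b′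
  ⊑-⊒-trans (inj₂ (_ , b≤ε))   (inj₂ (_ , b′≰ε))   = B.trans b≤ε (B.≰⇒≥ b′≰ε)

  ⊒-⊑-trans : ∀ {c b c′} → c ⊒ b → b ⊑ c′ → c C.≤ c′
  ⊒-⊑-trans (inj₁ c↖b)         (inj₁ b↗c′)         = ↖↗⇒≤ c↖b b↗c′
  ⊒-⊑-trans (inj₁ c↖b)         (inj₂ (c′↖̸b , _))   = ↖-↖̸⇒≤ c↖b c′↖̸b
  ⊒-⊑-trans (inj₂ (b↗̸c , _))   (inj₁ b↗c′)         = ↗̸-↗⇒≤ b↗̸c b↗c′
  ⊒-⊑-trans (inj₂ (_ , b≰ε))   (inj₂ (_ , b≤ε))    = contradiction b≤ε b≰ε

  -- An element of A is itself the witness for passing between its two copies, so this and the next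
  -- three lemmas reduce comparisons with image points to a single chain.
  ⊑-image : ∀ {b a} → b ⊑ g.⟦ a ⟧ → b B.≤ f.⟦ a ⟧
  ⊑-image b⊑a = ⊑-⊒-trans b⊑a (inj₁ (_ , C.refl , B.refl))

  image-⊑ : ∀ {a c} → f.⟦ a ⟧ ⊑ c → g.⟦ a ⟧ C.≤ c
  image-⊑ a⊑c = ⊒-⊑-trans (inj₁ (_ , C.refl , B.refl)) a⊑c

  ⊒-image : ∀ {c a} → c ⊒ f.⟦ a ⟧ → c C.≤ g.⟦ a ⟧
  ⊒-image c⊒a = ⊒-⊑-trans c⊒a (inj₁ (_ , B.refl , C.refl))

  image-⊒ : ∀ {a b} → g.⟦ a ⟧ ⊒ b → f.⟦ a ⟧ B.≤ b
  image-⊒ a⊒b = ⊑-⊒-trans (inj₁ (_ , B.refl , C.refl)) a⊒b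

  ↗ˡ⇒↖ʳ : ∀ {b c} → b ↗ (c C.ˡ) → c ↖ (b B.ʳ)
  ↗ˡ⇒↖ʳ (a , b≤a , a≤cˡ) =
    a A.ʳ , C.trans (C.galois-to a≤cˡ) (C.reflexive (C.Eq.sym (g.ʳ-homo a))) , fP.≤⟦⟧⇒⟦ʳ⟧≤ʳ b≤a

  ↖ʳ⇒↗ˡ : ∀ {b c} → c ↖ (b B.ʳ) → b ↗ (c C.ˡ)
  ↖ʳ⇒↗ˡ (a , c≤a , a≤bʳ) =
    a A.ˡ , fP.⟦⟧≤ʳ⇒≤⟦ˡ⟧ a≤bʳ , C.trans (C.reflexive (g.ˡ-homo a)) (C.ˡ-anti c≤a)

  -- A witness a is carried to `a A.ʳ`. A tie at b outside the image is carried to a tie at `b B.ʳ`: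
  -- since `b ≤ ε`, that residual is at least ε, and fullness excludes equality. So the residual
  -- switches sides of ε exactly as the tie rule demands.
  ⊑⇒⊒ : ∀ {b c} → b ⊑ (c C.ˡ) → c ⊒ (b B.ʳ)
  ⊑⇒⊒ (inj₁ b↗cˡ) = inj₁ (↗ˡ⇒↖ʳ b↗cˡ)
  ⊑⇒⊒ {b} {c} b⊑cˡ@(inj₂ (cˡ↖̸b , b≤ε)) with em {f.InImage b}
  ... | yes (a , a≈b) = inj₁ (↗ˡ⇒↖ʳ
    (a , B.reflexive (B.Eq.sym a≈b) , image-⊑ (≤-⊑-trans (B.reflexive a≈b) b⊑cˡ)))
  ... | no b∉f = inj₂ (bʳ↗̸c , bʳ≰ε)
    where
    bʳ↗̸c : ¬ ((b B.ʳ) ↗ c)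
    bʳ↗̸c (a , bʳ≤a , a≤c) = fP.ʳ-notBoth b∉f (fP.≤⟦ˡ⟧⇒⟦⟧≤ʳ (B.≰⇒≥ aˡ≰b)) bʳ≤a
      where
      aˡ≰b : ¬ (f.⟦ a A.ˡ ⟧ B.≤ b)
      aˡ≰b aˡ≤b = cˡ↖̸b (a A.ˡ , C.trans (C.ˡ-anti a≤c) (C.reflexive (C.Eq.sym (g.ˡ-homo a))) , aˡ≤b)

    bʳ≰ε : ¬ (b B.ʳ B.≤ B.ε)
    bʳ≰ε bʳ≤ε = fP.ʳ-notBoth b∉f (B.trans fP.⟦ε⟧≤ε (B.x≤ε⇒ε≤xʳ b≤ε)) (B.trans bʳ≤ε fP.ε≤⟦ε⟧)

  -- Now the tie is split on c. If c is an image point, it supplies a witness; otherwise fullness of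
  -- g rules out a witness for the reverse comparison.
  ⊒⇒⊑ : ∀ {b c} → c ⊒ (b B.ʳ) → b ⊑ (c C.ˡ)
  ⊒⇒⊑ (inj₁ c↖bʳ) = inj₁ (↖ʳ⇒↗ˡ c↖bʳ)
  ⊒⇒⊑ {b} {c} c⊒bʳ@(inj₂ (bʳ↗̸c , bʳ≰ε)) with em {g.InImage c}
  ... | yes (a , a≈c) = inj₁ (↖ʳ⇒↗ˡ
    (a , C.reflexive (C.Eq.sym a≈c) , image-⊒ (≤-⊒-trans (C.reflexive a≈c) c⊒bʳ)))
  ... | no c∉g = inj₂ (cˡ↖̸b , B.ε≤xʳ⇒x≤ε (B.≰⇒≥ bʳ≰ε))
    where
    cˡ↖̸b : ¬ ((c C.ˡ) ↖ b)
    cˡ↖̸b (a , cˡ≤a , a≤b) = gP.ˡ-notBoth c∉g a≤cˡ cˡ≤a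
      where
      aʳ≰c : ¬ (g.⟦ a A.ʳ ⟧ C.≤ c)
      aʳ≰c aʳ≤c = bʳ↗̸c (a A.ʳ , fP.⟦⟧≤⇒ʳ≤⟦ʳ⟧ a≤b , aʳ≤c)

      a≤cˡ : g.⟦ a ⟧ C.≤ c C.ˡ
      a≤cˡ = C.galois-from (C.trans (C.≰⇒≥ aʳ≰c) (C.reflexive (g.ʳ-homo a)))

  -- For b in the image this is the covering condition in C. For other b no image point, and in
  -- particular not ε, separates `b B.ʳ` from a lower `b B.ˡ`, so the two hypotheses contradict each
  -- other.
  ⊒-covers : ∀ {b c} → c ⊒ (b B.ʳ) → ¬ (c ⊒ (b B.ˡ)) → (b B.ʳ) ⊑ c
  ⊒-covers {b} {c} c⊒bʳ c⋣bˡ with em {f.InImage b}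
  ... | yes (a , a≈b) = inj₁ (a A.ʳ , bʳ≤aʳ , aʳ≤c)
    where
    bʳ≤aʳ = fP.⟦⟧≤⇒ʳ≤⟦ʳ⟧ (B.reflexive a≈b)

    c≤aʳ : c C.≤ g.⟦ a ⟧ C.ʳ
    c≤aʳ = C.trans (⊒-image (⊒-≤-trans c⊒bʳ bʳ≤aʳ)) (C.reflexive (g.ʳ-homo a))

    c≰aˡ : ¬ (c C.≤ g.⟦ a ⟧ C.ˡ)
    c≰aˡ c≤aˡ = c⋣bˡ (inj₁ (a A.ˡ , C.trans c≤aˡ (C.reflexive (C.Eq.sym (g.ˡ-homo a))) ,
      B.trans (B.reflexive (f.ˡ-homo a)) (B.ˡ-anti (B.reflexive (B.Eq.sym a≈b)))))

    aʳ≤c : g.⟦ a A.ʳ ⟧ C.≤ c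
    aʳ≤c = C.trans (C.reflexive (g.ʳ-homo a)) (C.ʳ-covers-ˡ c≤aʳ c≰aˡ)
  ... | no b∉f = contradiction (c⊒bˡ c⊒bʳ) c⋣bˡ
    where
    c⊒bˡ : c ⊒ (b B.ʳ) → c ⊒ (b B.ˡ)
    c⊒bˡ (inj₁ (a , c≤a , a≤bʳ)) = inj₁ (a , c≤a , fP.⟦⟧≤ʳ⇒⟦⟧≤ˡ b∉f a≤bʳ)
    c⊒bˡ (inj₂ (bʳ↗̸c , bʳ≰ε)) = inj₂
      ( (λ (a , bˡ≤a , a≤c) → bʳ↗̸c (a , fP.ˡ≤⟦⟧⇒ʳ≤⟦⟧ b∉f bˡ≤a , a≤c))
      , (λ bˡ≤ε → bʳ≰ε (B.trans (fP.ˡ≤⟦⟧⇒ʳ≤⟦⟧ b∉f (B.trans bˡ≤ε fP.ε≤⟦ε⟧)) fP.⟦ε⟧≤ε)))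

  ⊑-covers : ∀ {b c} → b ⊑ (c C.ʳ) → ¬ (b ⊑ (c C.ˡ)) → (c C.ʳ) ⊒ b
  ⊑-covers {b} {c} b⊑cʳ b⋢cˡ with em {g.InImage c}
  ... | yes (a , a≈c) = inj₁ (a A.ʳ , cʳ≤aʳ , aʳ≤b)
    where
    cʳ≤aʳ = gP.⟦⟧≤⇒ʳ≤⟦ʳ⟧ (C.reflexive a≈c)

    b≤aʳ : b B.≤ f.⟦ a ⟧ B.ʳ
    b≤aʳ = B.trans (⊑-image (⊑-≤-trans b⊑cʳ cʳ≤aʳ)) (B.reflexive (f.ʳ-homo a))

    b≰aˡ : ¬ (b B.≤ f.⟦ a ⟧ B.ˡ)
    b≰aˡ b≤aˡ = b⋢cˡ (inj₁ (a A.ˡ , B.trans b≤aˡ (B.reflexive (B.Eq.sym (f.ˡ-homo a))) ,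
      C.trans (C.reflexive (g.ˡ-homo a)) (C.ˡ-anti (C.reflexive (C.Eq.sym a≈c)))))

    aʳ≤b : f.⟦ a A.ʳ ⟧ B.≤ b
    aʳ≤b = B.trans (B.reflexive (f.ʳ-homo a)) (B.ʳ-covers-ˡ b≤aʳ b≰aˡ)
  ... | no c∉g = contradiction (b⊑cˡ b⊑cʳ) b⋢cˡ
    where
    b⊑cˡ : b ⊑ (c C.ʳ) → b ⊑ (c C.ˡ)
    b⊑cˡ (inj₁ (a , b≤a , a≤cʳ)) = inj₁ (a , b≤a , gP.⟦⟧≤ʳ⇒⟦⟧≤ˡ c∉g a≤cʳ)
    b⊑cˡ (inj₂ (cʳ↖̸b , b≤ε)) = inj₂
      ((λ (a , cˡ≤a , a≤b) → cʳ↖̸b (a , gP.ˡ≤⟦⟧⇒ʳ≤⟦⟧ c∉g cˡ≤a , a≤b)) , b≤ε)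

  -- This makes the amalgam strong. A witness of either comparison is squeezed onto both b and c,
  -- while two uses of the tie rule would put b on both sides of ε.
  ⊑-⊒⇒common : ∀ {b c} → b ⊑ c → c ⊒ b → ∃[ a ] f.⟦ a ⟧ B.≈ b × g.⟦ a ⟧ C.≈ c
  ⊑-⊒⇒common b⊑c@(inj₁ (a , b≤a , a≤c)) c⊒b = a , B.antisym a≤b b≤a , C.antisym a≤c c≤a
    where
    a≤b = image-⊒ (≤-⊒-trans a≤c c⊒b)
    c≤a = ⊒-image (⊒-≤-trans c⊒b b≤a)
  ⊑-⊒⇒common b⊑c (inj₁ (a , c≤a , a≤b)) = a , B.antisym a≤b b≤a , C.antisym a≤c c≤a
    where
    b≤a = ⊑-image (⊑-≤-trans b⊑c c≤a)
    a≤c = image-⊑ (≤-⊑-trans a≤b b⊑c)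
  ⊑-⊒⇒common (inj₂ (_ , b≤ε)) (inj₂ (_ , b≰ε)) = contradiction b≤ε b≰ε

-- The amalgam as a Galois chain.

module AmalgamChain
  (em : ExcludedMiddle (c ⊔ ℓ)) {A B C : GaloisChain c ℓ}
  {f : GaloisEmbedding A B} {g : GaloisEmbedding A C}
  (f-full : IsFull f) (g-full : IsFull g) where

  private
    module B  = GaloisChain B
    module C  = GaloisChain C

  open Amalgam em f-full g-full
  -- The gluing order does not mention the residuals, so the opposite chains produce the same `_⊑_`
  -- and `_⊒_`; this supplies the mirrored lemmas for the same order.
  private module Op = Amalgam em (opposite-isFull f-full) (opposite-isFull g-full)

  -- The gluing order lives in level c ⊔ ℓ; excluded middle resizes it to level ℓ.
  Resize : Set (c ⊔ ℓ) → Set ℓ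
  Resize P = Lift ℓ (True (em {P}))

  resize : ∀ {P} → P → Resize P
  resize p = lift (fromWitness p)

  unresize : ∀ {P} → Resize P → P
  unresize (lift t) = toWitness t

  Carrier = B.Carrier ⊎ C.Carrier

  infix 4 _≤_ _≈_
  _≤_ : Carrier → Carrier → Set ℓ
  inj₁ b ≤ inj₁ b′ = b B.≤ b′
  inj₁ b ≤ inj₂ c  = Resize (b ⊑ c)
  inj₂ c ≤ inj₁ b  = Resize (c ⊒ b)
  inj₂ c ≤ inj₂ c′ = c C.≤ c′

  -- Mutual inequality does the gluing: the carrier remains a disjoint union in which the two copies
  -- of an element of A are equal.
  _≈_ : Carrier → Carrier → Set ℓ
  _≈_ = SymInterior _≤_

  ≤-refl : Reflexive _≤_
  ≤-refl {inj₁ _} = B.refl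
  ≤-refl {inj₂ _} = C.refl

  ≤-trans : Transitive _≤_
  ≤-trans {inj₁ _} {inj₁ _} {inj₁ _} p q = B.trans p q
  ≤-trans {inj₁ _} {inj₁ _} {inj₂ _} p q = resize (≤-⊑-trans p (unresize q))
  ≤-trans {inj₁ _} {inj₂ _} {inj₁ _} p q = ⊑-⊒-trans (unresize p) (unresize q)
  ≤-trans {inj₁ _} {inj₂ _} {inj₂ _} p q = resize (⊑-≤-trans (unresize p) q)
  ≤-trans {inj₂ _} {inj₁ _} {inj₁ _} p q = resize (⊒-≤-trans (unresize p) q)
  ≤-trans {inj₂ _} {inj₁ _} {inj₂ _} p q = ⊒-⊑-trans (unresize p) (unresize q)
  ≤-trans {inj₂ _} {inj₂ _} {inj₁ _} p q = resize (≤-⊒-trans p (unresize q))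
  ≤-trans {inj₂ _} {inj₂ _} {inj₂ _} p q = C.trans p q

  ≤-total : Total _≤_
  ≤-total (inj₁ b) (inj₁ b′) = B.total b b′
  ≤-total (inj₁ b) (inj₂ c)  = Sum.map resize resize (⊑-total b c)
  ≤-total (inj₂ c) (inj₁ b)  = Sum.map resize resize (Sum.swap (⊑-total b c))
  ≤-total (inj₂ c) (inj₂ c′) = C.total c c′

  _ʳ _ˡ : Carrier → Carrier
  _ʳ = Sum.map B._ʳ C._ʳ
  _ˡ = Sum.map B._ˡ C._ˡ

  ≤ˡ⇒≤ʳ : ∀ x y → x ≤ y ˡ → y ≤ x ʳ
  ≤ˡ⇒≤ʳ (inj₁ _) (inj₁ _) p = B.galois-to p
  ≤ˡ⇒≤ʳ (inj₁ _) (inj₂ _) p = resize (⊑⇒⊒ (unresize p))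
  ≤ˡ⇒≤ʳ (inj₂ _) (inj₁ _) p = resize (Op.⊒⇒⊑ (unresize p))
  ≤ˡ⇒≤ʳ (inj₂ _) (inj₂ _) p = C.galois-to p

  ≤ʳ⇒≤ˡ : ∀ x y → y ≤ x ʳ → x ≤ y ˡ
  ≤ʳ⇒≤ˡ (inj₁ _) (inj₁ _) p = B.galois-from p
  ≤ʳ⇒≤ˡ (inj₁ _) (inj₂ _) p = resize (⊒⇒⊑ (unresize p))
  ≤ʳ⇒≤ˡ (inj₂ _) (inj₁ _) p = resize (Op.⊑⇒⊒ (unresize p))
  ≤ʳ⇒≤ˡ (inj₂ _) (inj₂ _) p = C.galois-from p

  ʳ-covers-ˡ : ∀ x y → x ≤ y ʳ → ¬ (x ≤ y ˡ) → y ʳ ≤ x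
  ʳ-covers-ˡ (inj₁ _) (inj₁ _) p ¬q = B.ʳ-covers-ˡ p ¬q
  ʳ-covers-ˡ (inj₁ _) (inj₂ _) p ¬q = resize (⊑-covers (unresize p) (¬q ∘ resize))
  ʳ-covers-ˡ (inj₂ _) (inj₁ _) p ¬q = resize (⊒-covers (unresize p) (¬q ∘ resize))
  ʳ-covers-ˡ (inj₂ _) (inj₂ _) p ¬q = C.ʳ-covers-ˡ p ¬q

  ˡ-covers-ʳ : ∀ x y → x ≤ y ˡ → ¬ (x ≤ y ʳ) → y ˡ ≤ x
  ˡ-covers-ʳ (inj₁ _) (inj₁ _) p ¬q = B.ˡ-covers-ʳ p ¬q
  ˡ-covers-ʳ (inj₁ _) (inj₂ _) p ¬q = resize (Op.⊑-covers (unresize p) (¬q ∘ resize))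
  ˡ-covers-ʳ (inj₂ _) (inj₁ _) p ¬q = resize (Op.⊒-covers (unresize p) (¬q ∘ resize))
  ˡ-covers-ʳ (inj₂ _) (inj₂ _) p ¬q = C.ˡ-covers-ʳ p ¬q

  galoisChain : GaloisChain c ℓ
  galoisChain = record
    { decTotalOrder = record
      { isDecTotalOrder = record
        { isTotalOrder = record
          { isPartialOrder = SymInterior.isPartialOrder
              (λ {x} → ≤-refl {x}) (λ {x y z} → ≤-trans {x} {y} {z})
          ; total          = ≤-total
          }
        ; _≟_  = λ _ _ → excludedMiddle-lower {c} em
        ; _≤?_ = λ _ _ → excludedMiddle-lower {c} em
        }
      }
    ; ε           = inj₁ B.ε
    ; _ʳ          = _ʳ
    ; _ˡ          = _ˡ
    ; galois-to   = λ {x} {y} → ≤ˡ⇒≤ʳ x y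
    ; galois-from = λ {x} {y} → ≤ʳ⇒≤ˡ x y
    ; εʳ≈ε        = B.reflexive B.εʳ≈ε , B.reflexive (B.Eq.sym B.εʳ≈ε)
    ; εˡ≈ε        = B.reflexive B.εˡ≈ε , B.reflexive (B.Eq.sym B.εˡ≈ε)
    ; ʳ-covers-ˡ  = λ {x} {y} → ʳ-covers-ˡ x y
    ; ˡ-covers-ʳ  = λ {x} {y} → ˡ-covers-ʳ x y
    }

  image≈image : ∀ a → inj₁ (GaloisEmbedding.⟦ f ⟧ a) ≈ inj₂ (GaloisEmbedding.⟦ g ⟧ a)
  image≈image a = resize (inj₁ (a , B.refl , C.refl)) , resize (inj₁ (a , C.refl , B.refl))

  inj₁-embedding : GaloisEmbedding B galoisChain
  inj₁-embedding = record
    { ⟦_⟧    = inj₁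
    ; mono   = λ p → p
    ; cancel = λ p → p
    ; ε-homo = ≤-refl {inj₁ B.ε} , ≤-refl {inj₁ B.ε}
    ; ʳ-homo = λ _ → B.refl , B.refl
    ; ˡ-homo = λ _ → B.refl , B.refl
    }

  inj₂-embedding : GaloisEmbedding C galoisChain
  inj₂-embedding = record
    { ⟦_⟧    = inj₂
    ; mono   = λ p → p
    ; cancel = λ p → p
    ; ε-homo =
          resize (inj₁ (_ , C.reflexive (C.Eq.sym (GaloisEmbedding.ε-homo g))
                          , B.reflexive (GaloisEmbedding.ε-homo f)))
        , resize (inj₁ (_ , B.reflexive (B.Eq.sym (GaloisEmbedding.ε-homo f))
                          , C.reflexive (GaloisEmbedding.ε-homo g)))
    ; ʳ-homo = λ _ → C.refl , C.refl
    ; ˡ-homo = λ _ → C.refl , C.refl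
    }

-- Embeddings of Galois chains as embeddings of residuated lattices.

module OrderEmbedding
  (em : ExcludedMiddle ℓ) {A B : ResiduatedLattice c ℓ}
  (KA : IsIdempotentResiduatedChain A) (KB : IsIdempotentResiduatedChain B)
  (f : GaloisEmbedding (ToGaloisChain.galoisChain em KA) (ToGaloisChain.galoisChain em KB))
  where
  private module A = ChainProperties KA
  open ChainProperties KB
  open GaloisEmbedding f

  ∧-homo : ∀ x y → ⟦ x A.∧ y ⟧ ≈ ⟦ x ⟧ ∧ ⟦ y ⟧
  ∧-homo x y = ≤-antisym
    (∧-greatest (mono (A.x∧y≤x x y)) (mono (A.x∧y≤y x y)))
    ([ (λ x≤y → ≤-trans (x∧y≤x _ _) (mono (A.∧-greatest A.≤-refl x≤y)))
     , (λ y≤x → ≤-trans (x∧y≤y _ _) (mono (A.∧-greatest y≤x A.≤-refl)))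
     ]′ (A.≤-total x y))

  ∨-homo : ∀ x y → ⟦ x A.∨ y ⟧ ≈ ⟦ x ⟧ ∨ ⟦ y ⟧
  ∨-homo x y = ≤-antisym
    ([ (λ x≤y → ≤-trans (mono (A.∨-least x≤y A.≤-refl)) (y≤x∨y _ _))
     , (λ y≤x → ≤-trans (mono (A.∨-least A.≤-refl y≤x)) (x≤x∨y _ _))
     ]′ (A.≤-total x y))
    (∨-least (mono (A.x≤x∨y x y)) (mono (A.y≤x∨y x y)))

  xy≤ε⇒⟦x⟧⟦y⟧≤ε : ∀ {x y} → x A.∙ y A.≤ A.ε → ⟦ x ⟧ ∙ ⟦ y ⟧ ≤ ε
  xy≤ε⇒⟦x⟧⟦y⟧≤ε xy≤ε = //-from (≤-trans (mono (A.//-to xy≤ε)) (≤-reflexive (ˡ-homo _)))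

  ⟦x⟧⟦y⟧≤ε⇒xy≤ε : ∀ {x y} → ⟦ x ⟧ ∙ ⟦ y ⟧ ≤ ε → x A.∙ y A.≤ A.ε
  ⟦x⟧⟦y⟧≤ε⇒xy≤ε xy≤ε =
    A.//-from (cancel (≤-trans (//-to xy≤ε) (≤-reflexive (sym (ˡ-homo _)))))

  -- Comparing `x ∙ y` with ε amounts to comparing x with `y ˡ`, which f preserves and reflects. So
  -- both products can be read as meets or both as joins.
  ∙-homo : ∀ x y → ⟦ x A.∙ y ⟧ ≈ ⟦ x ⟧ ∙ ⟦ y ⟧
  ∙-homo x y with A.≤-total (x A.∙ y) A.ε | ≤-total (⟦ x ⟧ ∙ ⟦ y ⟧) ε
  ... | inj₁ xy≤ε | _ =
    trans (⟦⟧-cong (A.xy≤ε⇒xy≈x∧y xy≤ε))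
      (trans (∧-homo x y) (sym (xy≤ε⇒xy≈x∧y (xy≤ε⇒⟦x⟧⟦y⟧≤ε xy≤ε))))
  ... | inj₂ _ | inj₁ fxfy≤ε =
    trans (⟦⟧-cong (A.xy≤ε⇒xy≈x∧y (⟦x⟧⟦y⟧≤ε⇒xy≤ε fxfy≤ε)))
      (trans (∧-homo x y) (sym (xy≤ε⇒xy≈x∧y fxfy≤ε)))
  ... | inj₂ ε≤xy | inj₂ ε≤fxfy =
    trans (⟦⟧-cong (A.ε≤xy⇒xy≈x∨y ε≤xy)) (trans (∨-homo x y) (sym (ε≤xy⇒xy≈x∨y ε≤fxfy)))

  \\-homo : ∀ x y → ⟦ x A.\\ y ⟧ ≈ ⟦ x ⟧ \\ ⟦ y ⟧
  \\-homo x y with em {x A.≤ y}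
  ... | yes x≤y = trans (⟦⟧-cong (A.x≤z⇒x\\z≈xʳ∨z x≤y)) (trans (∨-homo (x A.ʳ) y)
    (trans (∨-cong (ʳ-homo x) refl) (sym (x≤z⇒x\\z≈xʳ∨z (mono x≤y)))))
  ... | no  x≰y = trans (⟦⟧-cong (A.x≰z⇒x\\z≈xʳ∧z x≰y)) (trans (∧-homo (x A.ʳ) y)
    (trans (∧-cong (ʳ-homo x) refl) (sym (x≰z⇒x\\z≈xʳ∧z (x≰y ∘ cancel)))))

module _
  (em : ExcludedMiddle ℓ) {A B : ResiduatedLattice c ℓ}
  (KA : IsIdempotentResiduatedChain A) (KB : IsIdempotentResiduatedChain B) where

  private
    module A = ChainProperties KA
    module B = ChainProperties KB
    GA = ToGaloisChain.galoisChain em KA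
    GB = ToGaloisChain.galoisChain em KB
    oppositeChain = opposite-isIdempotentResiduatedChain

  fromGaloisEmbedding : GaloisEmbedding GA GB → Embedding A B
  fromGaloisEmbedding f = record
    { ⟦_⟧         = ⟦_⟧
    ; isEmbedding = record
      { isLatticeMonomorphism = record
        { isLatticeHomomorphism = record
          { isRelHomomorphism = record { cong = ⟦⟧-cong }
          ; ∧-homo            = ∧-homo
          ; ∨-homo            = ∨-homo
          }
        ; injective = λ fx≈fy → A.≤-antisym
            (cancel (B.≤-reflexive fx≈fy)) (cancel (B.≤-reflexive (B.sym fx≈fy)))
        }
      ; ∙-homo  = ∙-homo
      ; \\-homo = \\-homo
      ; //-homo = flip (OrderEmbedding.\\-homo em (oppositeChain KA) (oppositeChain KB) fᵒ)
      ; ε-homo  = ε-homo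
      }
    }
    where
    open GaloisEmbedding f
    open OrderEmbedding em KA KB f

    fᵒ : GaloisEmbedding (ToGaloisChain.galoisChain em (oppositeChain KA))
                         (ToGaloisChain.galoisChain em (oppositeChain KB))
    fᵒ = record
      { ⟦_⟧    = ⟦_⟧
      ; mono   = mono
      ; cancel = cancel
      ; ε-homo = ε-homo
      ; ʳ-homo = ˡ-homo
      ; ˡ-homo = ʳ-homo
      }

  toGaloisEmbedding : Embedding A B → GaloisEmbedding GA GB
  toGaloisEmbedding f = record
    { ⟦_⟧    = ⟦_⟧
    ; mono   = λ x≤y → B.trans (⟦⟧-cong x≤y) (∧-homo _ _)
    ; cancel = λ fx≤fy → injective (B.trans fx≤fy (B.sym (∧-homo _ _)))
    ; ε-homo = ε-homo
    ; ʳ-homo = λ x → B.trans (\\-homo x A.ε) (B.\\-congˡ ε-homo)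
    ; ˡ-homo = λ x → B.trans (//-homo A.ε x) (B.//-congʳ ε-homo)
    }
    where open Embedding f

  -- The star is a meet of residuals, so f commutes with it. Every element of the amalgam comes from
  -- B or C, and its involutivity follows from this.
  ⋆-involutive-image :
    (f : GaloisEmbedding GA GB) → let open GaloisEmbedding f in
    ∀ {x} → (x A.⋆) A.⋆ A.≈ x → (⟦ x ⟧ B.⋆) B.⋆ B.≈ ⟦ x ⟧
  ⋆-involutive-image f {x} x⋆⋆≈x =
    B.trans (B.⋆-cong (B.sym (⋆-homo x))) (B.trans (B.sym (⋆-homo (x A.⋆))) (⟦⟧-cong x⋆⋆≈x))
    where
    open GaloisEmbedding f
    open OrderEmbedding em KA KB f

    ⋆-homo : ∀ y → ⟦ y A.⋆ ⟧ B.≈ ⟦ y ⟧ B.⋆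
    ⋆-homo y = B.trans (∧-homo (y A.ˡ) (y A.ʳ)) (B.∧-cong (ˡ-homo y) (ʳ-homo y))

module _
  (em : ExcludedMiddle ℓ) {A B : ResiduatedLattice c ℓ}
  (KA : Is⋆InvolutiveIdempotentResiduatedChain A)
  (KB : Is⋆InvolutiveIdempotentResiduatedChain B) where

  private
    module KA = Is⋆InvolutiveIdempotentResiduatedChain KA
    module KB = Is⋆InvolutiveIdempotentResiduatedChain KB
    open ChainProperties KB.isIdempotentResiduatedChain

  -- Each element is a residual of each of its own residuals, and the image is closed under
  -- residuals.
  toGaloisEmbedding-isFull :
    (f : Embedding A B) →
    IsFull (toGaloisEmbedding em KA.isIdempotentResiduatedChain KB.isIdempotentResiduatedChain f)
  toGaloisEmbedding-isFull f = record
    { ʳ-reflects = λ {b} → reflects (ʳ-recovers em KB b)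
    ; ˡ-reflects = λ {b} → reflects (ˡ-recovers em KB b)
    }
    where
    open GaloisEmbedding (toGaloisEmbedding em
      KA.isIdempotentResiduatedChain KB.isIdempotentResiduatedChain f)

    reflects : ∀ {b y} → b ≈ y ʳ ⊎ b ≈ y ˡ → InImage y → InImage b
    reflects (inj₁ b≈yʳ) (a , a≈y) = _ , trans (ʳ-homo a) (trans (ʳ-cong a≈y) (sym b≈yʳ))
    reflects (inj₂ b≈yˡ) (a , a≈y) = _ , trans (ˡ-homo a) (trans (ˡ-cong a≈y) (sym b≈yˡ))

-- Assembling the strong amalgam.

module _ (em : ExcludedMiddle ℓ) (G : GaloisChain c ℓ) where
  open GaloisChain G
  open FromGaloisChain G

  -- The elements stay the same, but the order turns into `x ≈ x ∧ y` and the residuals into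
  -- divisions of ε, so the identity map has to be checked.
  roundTrip : GaloisEmbedding G (ToGaloisChain.galoisChain em isIdempotentResiduatedChain)
  roundTrip = record
    { ⟦_⟧    = λ x → x
    ; mono   = ≤⇒≈∧
    ; cancel = ≈∧⇒≤
    ; ε-homo = Eq.refl
    ; ʳ-homo = λ x → Eq.sym (Product.\\ε≈ʳ G x)
    ; ˡ-homo = λ x → Eq.sym (Product.\\ε≈ʳ (opposite G) x)
    }

composeEmbedding : {A B C : GaloisChain c ℓ} →
  GaloisEmbedding B C → GaloisEmbedding A B → GaloisEmbedding A C
composeEmbedding {C = C} g f = record
  { ⟦_⟧    = g.⟦_⟧ ∘ f.⟦_⟧
  ; mono   = g.mono ∘ f.mono
  ; cancel = f.cancel ∘ g.cancel
  ; ε-homo = trans (⟦⟧-cong f.ε-homo) g.ε-homo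
  ; ʳ-homo = λ x → trans (⟦⟧-cong (f.ʳ-homo x)) (g.ʳ-homo f.⟦ x ⟧)
  ; ˡ-homo = λ x → trans (⟦⟧-cong (f.ˡ-homo x)) (g.ˡ-homo f.⟦ x ⟧)
  }
  where
  module f = GaloisEmbedding f
  module g = GaloisEmbedding g
  open GaloisEmbedding g using (⟦⟧-cong)
  open GaloisChain.Eq C using (trans)

theorem5p7 : {c ℓ : Level} → ExcludedMiddle (c ⊔ ℓ) →
    StrongAmalgamationProperty {c} {ℓ} Is⋆InvolutiveIdempotentResiduatedChain
theorem5p7 {c} {ℓ} em A B C KA KB KC fB fC = residuatedLattice , KD , gB , gC , record
  { commutes = image≈image
  ; strong   =
      (λ (a , fa≈d) → (_ , fa≈d) , (_ , D.Eq.trans (D.Eq.sym (image≈image a)) fa≈d))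
    -- The common value d identifies `inj₁ b` with `inj₂ c`, which forces both to come from one
    -- element of A.
    , (λ ((b , b≈d) , (c , c≈d)) → common-image b≈d (D.Eq.trans b≈d (D.Eq.sym c≈d)))
  }
  where
  em′ = excludedMiddle-lower {c} {ℓ} em
  module KA = Is⋆InvolutiveIdempotentResiduatedChain KA
  module KB = Is⋆InvolutiveIdempotentResiduatedChain KB
  module KC = Is⋆InvolutiveIdempotentResiduatedChain KC
  fB-full = toGaloisEmbedding-isFull em′ KA KB fB
  fC-full = toGaloisEmbedding-isFull em′ KA KC fC

  open Amalgam em fB-full fC-full using (⊑-⊒⇒common)
  open AmalgamChain em fB-full fC-full
  open FromGaloisChain galoisChain
  module D = GaloisChain galoisChain

  ιB = composeEmbedding (roundTrip em′ galoisChain) inj₁-embedding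
  ιC = composeEmbedding (roundTrip em′ galoisChain) inj₂-embedding
  gB = fromGaloisEmbedding em′ KB.isIdempotentResiduatedChain isIdempotentResiduatedChain ιB
  gC = fromGaloisEmbedding em′ KC.isIdempotentResiduatedChain isIdempotentResiduatedChain ιC

  KD : Is⋆InvolutiveIdempotentResiduatedChain residuatedLattice
  KD = record
    { isIdempotentResiduatedChain = isIdempotentResiduatedChain
    ; ⋆-involutive = λ where
        (inj₁ b) → ⋆-involutive-image em′ KB.isIdempotentResiduatedChain
          isIdempotentResiduatedChain ιB (KB.⋆-involutive b)
        (inj₂ c) → ⋆-involutive-image em′ KC.isIdempotentResiduatedChain
          isIdempotentResiduatedChain ιC (KC.⋆-involutive c)
    }

  common-image : ∀ {b c d} → inj₁ b ≈ d → inj₁ b ≈ inj₂ c →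
    ∃[ a ] inj₁ (Embedding.⟦ fB ⟧ a) ≈ d
  common-image b≈d (b≤c , c≤b) =
    let a , fa≈b , _ = ⊑-⊒⇒common (unresize b≤c) (unresize c≤b)
    in a , D.Eq.trans (B.reflexive fa≈b , B.reflexive (B.Eq.sym fa≈b)) b≈d
    where module B = GaloisChain (ToGaloisChain.galoisChain em′ KB.isIdempotentResiduatedChain)
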